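{- Let $p$ be an ultrafilter on $\mathbb{N}$. If $p$ is strongly summable, then $p$ is rapid.
   Context: $\mathbb{N}=\{1,2,3,\dots\}$ is the set of positive integers and $\omega=\{0,1,2,\dots\}$. The semigroup under consideration is $(\mathbb{N},+)$. FS-set: for a sequence $(x_n)_{n\in\omega}$ in $\mathbb{N}$, put $$FS(x_n)=\Big\{\sum_{n\in s}x_n : s\subseteq\omega \text{ finite},\ s\neq\emptyset\Big\}.$$ A set of this form is called an FS-set. Strongly summable: an ultrafilter $p$ on $\mathbb{N}$ is strongly summable if it has a base of FS-sets, i.e. for every $A\in p$ there is a sequence $(x_n)_{n\in\omega}$ in $\mathbb{N}$ with $FS(x_n)\subseteq A$ and $FS(x_n)\in p$. Rapid: an ultrafilter $p$ on $\mathbb{N}$ is rapid if for every function $f:\mathbb{N}\to\mathbb{N}$ there exists $A\in p$ such that $|A\cap f(i)|<i$ for all $i\in\mathbb{N}$, where the natural number $f(i)$ is identified with the set of its predecessors, so that $A\cap f(i)=\{a\in A: a<f(i)\}$. -}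

module Defs where

open import Level using (Level; 0ℓ; _⊔_) renaming (suc to lsuc)
open import Data.List using (List; []; length; map; sum)
open import Data.List.Membership.Propositional using () renaming (_∈_ to _∈ₗ_)
open import Data.List.Relation.Unary.Unique.Propositional using (Unique)
open import Data.Nat using (ℕ; _<_; NonZero)
open import Data.Product using (∃-syntax; _×_)
open import Data.Refinement using (Refinement-syntax; value)
open import Data.Sum using (_⊎_)
open import Function.Bundles using (_⇔_)
open import Relation.Binary.PropositionalEquality using (_≡_; _≢_)
open import Relation.Unary using (Pred; _∈_; _∉_; _⊆_; _∩_; ∁; U; ∅)

private
  variable
    a ℓ : Level

ℕ⁺ : Set
ℕ⁺ = [ n ∈ ℕ ∣ NonZero n ]

-- Subsets of X are the predicates X → Set. The level ℓ of the membership
-- relation is left free.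
record Ultrafilter (X : Set) (ℓ : Level) : Set (lsuc 0ℓ ⊔ lsuc ℓ) where
  field
    sets     : Pred (Pred X 0ℓ) ℓ
    U∈       : U ∈ sets
    ∅∉       : ∅ ∉ sets
    upward   : ∀ {A B} → A ⊆ B → A ∈ sets → B ∈ sets
    ∩-closed : ∀ {A B} → A ∈ sets → B ∈ sets → (A ∩ B) ∈ sets
    ultra    : ∀ A → A ∈ sets ⊎ ∁ A ∈ sets

open Ultrafilter public using (sets)

-- A finite nonempty s ⊆ ω is a nonempty list without repetitions.
FS : (ℕ → ℕ⁺) → Pred ℕ⁺ 0ℓ
FS x b = ∃[ s ] Unique s × s ≢ [] × value b ≡ sum (map (λ n → value (x n)) s)

StronglySummable : Ultrafilter ℕ⁺ ℓ → Set (lsuc 0ℓ ⊔ ℓ)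
StronglySummable p = ∀ A → A ∈ sets p → ∃[ x ] FS x ⊆ A × FS x ∈ sets p

-- Counting is by enumeration rather than by a bijection with Σ X A, since
-- A b may have several proofs.
HasCardinality : {X : Set a} → Pred X ℓ → ℕ → Set (a ⊔ ℓ)
HasCardinality {X = X} A k =
  ∃[ xs ] Unique xs × (∀ (b : X) → b ∈ₗ xs ⇔ b ∈ A) × length xs ≡ k

Below : ℕ⁺ → Pred ℕ⁺ 0ℓ
Below m b = value b < value m

Rapid : Ultrafilter ℕ⁺ ℓ → Set (lsuc 0ℓ ⊔ ℓ)
Rapid p = ∀ (f : ℕ⁺ → ℕ⁺) → ∃[ A ] A ∈ sets p ×
  (∀ i → ∃[ k ] HasCardinality (A ∩ Below (f i)) k × k < value i)

{-# OPTIONS --safe #-}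

-- Write the elements of ℕ⁺ in base 3. One of the two classes given by the last
-- nonzero digit d lies in p; if FS x is contained in it, then the terms x n
-- have distinct 3-adic valuations, since two terms of equal valuation have a
-- sum with last nonzero digit 2d mod 3 ≠ d.
--
-- For every h, the set of b with h(v₃ b) ≤ b lies in p. Otherwise some FS x
-- lies in the complement, and as x 0 + x n has the valuation of x 0 whenever
-- x n has a larger one, the values x 0 + x n < h(v₃ (x 0)) stay bounded while
-- the valuations of the x n are distinct.
--
-- Take h a ≥ f i for all i < 2^(a+1). If FS x is contained in that set and
-- 2^k ≤ i < 2^(k+1), an element of FS x below f i is a nonempty sum of terms of
-- valuation less than k, and there are at most 2^k - 1 < i of these.
--
-- Excluded middle for sets is available because a strongly summable ultrafilter
-- decides the constant predicates and inhabits those it contains.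
module Submission where

open import Defs
open import Axiom.ExcludedMiddle using (ExcludedMiddle)
open import Data.Fin using (zero; suc; toℕ; fromℕ<)
open import Data.Fin.Properties using (pigeonhole; fromℕ<-injective)
open import Data.Irrelevant using ([_])
open import Data.List using (List; []; _∷_; _++_; length; map; filter; deduplicate)
open import Data.List.Membership.Propositional using () renaming (_∈_ to _∈ₗ_; _∉_ to _∉ₗ_)
open import Data.List.Membership.Propositional.Properties
  using (∈-++⁺ˡ; ∈-++⁺ʳ; ∈-map⁺; ∈-∃++; ∈-filter⁺; ∈-filter⁻; ∈-deduplicate⁺)
open import Data.List.Properties using (length-++; length-map; length-filter; length-deduplicate)
open import Data.List.Relation.Binary.Permutation.Propositional using (_↭_; ↭⇒↭ₛ)
open import Data.List.Relation.Binary.Permutation.Propositional.Properties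
  using (shift; All-resp-↭) renaming (map⁺ to ↭-map⁺)
open import Data.List.Relation.Binary.Permutation.Setoid.Properties using (Unique-resp-↭)
open import Data.List.Relation.Unary.All using (All; []; _∷_; tabulate; lookup)
open import Data.List.Relation.Unary.AllPairs using ([]; _∷_)
open import Data.List.Relation.Unary.Any using (here; there)
open import Data.List.Relation.Unary.Unique.Propositional using (Unique)
open import Data.List.Relation.Unary.Unique.Propositional.Properties
  using (Unique[x∷xs]⇒x∉xs) renaming (filter⁺ to Unique-filter⁺)
open import Data.List.Relation.Unary.Unique.DecPropositional.Properties using (deduplicate-!)
open import Data.Nat
open import Data.Nat.Divisibility
open import Data.Nat.DivMod using (_divMod_; result)
open import Data.Nat.Induction using (<-rec)
open import Data.Nat.ListAction using (sum)
open import Data.Nat.ListAction.Properties using (sum-↭)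
open import Data.Nat.Properties
open import Data.Nat.Tactic.RingSolver using (solve-∀)
open import Data.Product using (∃-syntax; _×_; _,_; proj₁; proj₂; map₂)
open import Data.Refinement using (value; _,_; value-injective) renaming (_≟_ to ≟-refinement)
open import Data.Sum using (_⊎_; inj₁; inj₂)
open import Data.Empty using (⊥-elim)
open import Function using (_∘_; mk⇔; case_of_)
open import Level using (Level; 0ℓ)
open import Relation.Binary.Definitions using (DecidableEquality)
open import Relation.Binary.PropositionalEquality
  using (_≡_; _≢_; refl; sym; trans; cong; subst; setoid; module ≡-Reasoning)
open import Relation.Nullary using (¬_; yes; no; contradiction)
open import Relation.Unary using (Pred; _∈_; _⊆_; _∩_; ∁)

private
  variable
    ℓ : Level
    X : Set

-- Positive integers and elementary bounds

_+⁺_ : ℕ⁺ → ℕ⁺ → ℕ⁺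
(m , [ m≢0 ]) +⁺ (n , _) =
  m + n , [ >-nonZero (<-≤-trans (>-nonZero⁻¹ m {{m≢0}}) (m≤m+n m n)) ]

-- The junk value 0 ⁺ is 1.
_⁺ : ℕ → ℕ⁺
n ⁺ = suc (pred n) , [ _ ]

value⁺ : ∀ b → value b ⁺ ≡ b
value⁺ (n , [ n≢0 ]) = value-injective (suc-pred n {{n≢0}})

value>0 : (b : ℕ⁺) → 0 < value b
value>0 (n , [ n≢0 ]) = >-nonZero⁻¹ n {{n≢0}}

n<3^n : ∀ n → n < 3 ^ n
n<3^n zero    = z<s
n<3^n (suc n) = begin-strict
  suc n                      ≡⟨ +-comm 1 n ⟩
  n + 1                      <⟨ +-mono-<-≤ (n<3^n n) (m^n>0 3 n) ⟩
  3 ^ n + 3 ^ n              ≤⟨ +-monoʳ-≤ (3 ^ n) (m≤m+n (3 ^ n) _) ⟩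
  3 ^ suc n                  ∎
  where open ≤-Reasoning

upper-bound : (g : ℕ → ℕ) → ∀ n → ∃[ B ] (∀ {i} → i < n → g i ≤ B)
upper-bound g zero    = 0 , λ ()
upper-bound g (suc n) with upper-bound g n
... | B , g≤B = g n + B , λ {i} i<1+n → case m≤n⇒m<n∨m≡n (s≤s⁻¹ i<1+n) of λ where
  (inj₁ i<n)  → m≤n⇒m≤o+n (g n) (g≤B i<n)
  (inj₂ refl) → m≤m+n (g n) B

binary-log : ∀ n .{{_ : NonZero n}} → ∃[ k ] 2 ^ k ≤ n × n < 2 ^ suc k
binary-log 1 = 0 , ≤-refl , ≤-refl
binary-log (suc n@(suc _)) with binary-log n
... | k , lower , upper with m≤n⇒m<n∨m≡n upper
...   | inj₁ 1+n<2^1+k = k , m≤n⇒m≤1+n lower , 1+n<2^1+k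
...   | inj₂ 1+n≡2^1+k =
  suc k , ≤-reflexive (sym 1+n≡2^1+k) ,
  subst (_< 2 ^ suc (suc k)) (sym 1+n≡2^1+k) (^-monoʳ-< 2 (s≤s (s≤s z≤n)) (n<1+n (suc k)))

bounded-not-injective : ∀ (v : ℕ → ℕ) N → (∀ n → v n < N) → ¬ (∀ m n → v m ≡ v n → m ≡ n)
bounded-not-injective v N v<N v-inj
  with pigeonhole (n<1+n N) (λ i → fromℕ< (v<N (toℕ i)))
... | i , j , i<j , eq = <⇒≢ i<j (v-inj _ _ (fromℕ<-injective _ _ _ _ eq))

-- Ternary expansions

-- The ternary expansion of n ends in the digit d followed by a zeros.
record EndsIn (d a n : ℕ) : Set where
  constructor _,_
  field
    prefix    : ℕ
    expansion : n ≡ 3 ^ a * (3 * prefix + d)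

-- Cancel common factors 3; one left over on a single side would divide the cofactor on the other.
∤-cofactor-unique : ∀ a b {u v} → 3 ∤ u → 3 ∤ v → 3 ^ a * u ≡ 3 ^ b * v → u ≡ v
∤-cofactor-unique zero zero {u} {v} _ _ eq =
  trans (sym (*-identityˡ u)) (trans eq (*-identityˡ v))
∤-cofactor-unique zero (suc b) {u} {v} 3∤u _ eq =
  contradiction (subst (3 ∣_) (trans (sym eq) (*-identityˡ u)) (∣m⇒∣m*n v (m∣m*n (3 ^ b)))) 3∤u
∤-cofactor-unique (suc a) zero {u} {v} _ 3∤v eq =
  contradiction (subst (3 ∣_) (trans eq (*-identityˡ v)) (∣m⇒∣m*n u (m∣m*n (3 ^ a)))) 3∤v
∤-cofactor-unique (suc a) (suc b) {u} {v} 3∤u 3∤v eq =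
  ∤-cofactor-unique a b 3∤u 3∤v
    (*-cancelˡ-≡ _ _ 3 (trans (sym (*-assoc 3 (3 ^ a) u)) (trans eq (*-assoc 3 (3 ^ b) v))))

3∤3m+d : ∀ {d} m → 3 ∤ d → 3 ∤ 3 * m + d
3∤3m+d m 3∤d 3∣ = 3∤d (∣m+n∣m⇒∣n 3∣ (m∣m*n m))

3∤double : ∀ {d} → 3 ∤ d → 3 ∤ d + d
3∤double {d} 3∤d 3∣2d = 3∤d (∣m+n∣m⇒∣n (subst (3 ∣_) (eq d) (m∣m*n d)) 3∣2d)
  where
  eq : ∀ d → 3 * d ≡ (d + d) + d
  eq = solve-∀

EndsIn-exists : ∀ n → 0 < n → ∃[ a ] (EndsIn 1 a n ⊎ EndsIn 2 a n)
EndsIn-exists = <-rec P step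
  where
  P : ℕ → Set
  P n = 0 < n → ∃[ a ] (EndsIn 1 a n ⊎ EndsIn 2 a n)
  last-digit : ∀ q d → d + q * 3 ≡ 1 * (3 * q + d)
  last-digit = solve-∀
  append-zero : ∀ p u → p * u * 3 ≡ 3 * p * u
  append-zero = solve-∀
  step : ∀ n → (∀ {m} → m < n → P m) → P n
  step n rec n>0 with n divMod 3
  ... | result q (suc zero)       refl = 0 , inj₁ (q , last-digit q 1)
  ... | result q (suc (suc zero)) refl = 0 , inj₂ (q , last-digit q 2)
  -- Quotient and remainder cannot both be 0, as `n>0`, so the recursion runs on a smaller positive
  -- number.
  ... | result (suc q) zero       refl with rec (m<m*n (suc q) 3 (s≤s (s≤s z≤n))) z<s
  ...   | a , inj₁ (m , eq) = suc a , inj₁ (m , trans (cong (_* 3) eq) (append-zero (3 ^ a) _))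
  ...   | a , inj₂ (m , eq) = suc a , inj₂ (m , trans (cong (_* 3) eq) (append-zero (3 ^ a) _))

EndsIn⇒< : ∀ {d a n} → 3 ∤ d → EndsIn d a n → a < n
EndsIn⇒< {d} {a} {n} 3∤d (m , refl) = <-≤-trans (n<3^n a) (m≤m*n (3 ^ a) (3 * m + d) {{≢-nonZero u≢0}})
  where
  u≢0 : 3 * m + d ≢ 0
  u≢0 eq = 3∤3m+d m 3∤d (subst (3 ∣_) (sym eq) (3 ∣0))

-- The sum has a cofactor congruent to `d + d` modulo 3, which is prime to 3. Comparing it with the
-- unique cofactor `3 * o + d` and cancelling `d` leaves 3 dividing `d`.
EndsIn-double : ∀ {d a b m n} → 3 ∤ d → EndsIn d a m → EndsIn d a n → ¬ EndsIn d b (m + n)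
EndsIn-double {d} {a} {b} 3∤d (m , refl) (n , refl) (o , eq) =
  3∤d (∣m+n∣m⇒∣n {m = 3 * (m + n)} (subst (3 ∣_) (sym cofactors) (m∣m*n o)) (m∣m*n (m + n)))
  where
  factor : ∀ p m n d → p * (3 * m + d) + p * (3 * n + d) ≡ p * (3 * (m + n) + (d + d))
  factor = solve-∀
  cofactors : 3 * (m + n) + d ≡ 3 * o
  cofactors = +-cancelʳ-≡ d _ _ (trans (+-assoc (3 * (m + n)) d d)
    (∤-cofactor-unique a b (3∤3m+d (m + n) (3∤double 3∤d)) (3∤3m+d o 3∤d)
      (trans (sym (factor (3 ^ a) m n d)) eq)))

-- A multiple of `3 ^ suc a` changes only the digits in front of `d`, so it goes into the prefix.
EndsIn-absorbs : ∀ {d a b m n} → a < b → EndsIn d a m → EndsIn d b n → EndsIn d a (m + n)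
EndsIn-absorbs {d} {a} a<b (m , refl) (n , refl) with m≤n⇒∃[o]m+o≡n a<b
... | k , refl = m + 3 ^ k * (3 * n + d) , (begin
  3 ^ a * (3 * m + d) + 3 * 3 ^ (a + k) * (3 * n + d)
    ≡⟨ cong (λ p → 3 ^ a * (3 * m + d) + 3 * p * (3 * n + d)) (^-distribˡ-+-* 3 a k) ⟩
  3 ^ a * (3 * m + d) + 3 * (3 ^ a * 3 ^ k) * (3 * n + d)
    ≡⟨ factor (3 ^ a) (3 ^ k) m (3 * n + d) d ⟩
  3 ^ a * (3 * (m + 3 ^ k * (3 * n + d)) + d) ∎)
  where
  open ≡-Reasoning
  factor : ∀ p q m u d → p * (3 * m + d) + 3 * (p * q) * u ≡ p * (3 * (m + q * u) + d)
  factor = solve-∀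

-- Finite sums

term∈FS : ∀ x n → x n ∈ FS x
term∈FS x n = n ∷ [] , [] ∷ [] , (λ ()) , sym (+-identityʳ _)

pair∈FS : ∀ x {m n} → m ≢ n → (x m +⁺ x n) ∈ FS x
pair∈FS x {m} {n} m≢n =
  m ∷ n ∷ [] , (m≢n ∷ []) ∷ [] ∷ [] , (λ ()) , cong (value (x m) +_) (sym (+-identityʳ _))

∈⇒≤sum : ∀ (f : ℕ → ℕ) {n s} → n ∈ₗ s → f n ≤ sum (map f s)
∈⇒≤sum f {n} (here refl) = m≤m+n (f n) _
∈⇒≤sum f {s = m ∷ _} (there n∈s) = m≤n⇒m≤o+n (f m) (∈⇒≤sum f n∈s)

-- Counting subset sums

module _ (em : ExcludedMiddle 0ℓ) where

  -- The entry 0 is the empty sum, kept out of L so that L has fewer than 2 ^ k entries.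
  subset-sums : (x v : ℕ → ℕ) → (∀ m n → v m ≡ v n → m ≡ n) → ∀ k →
    ∃[ L ] length (0 ∷ L) ≤ 2 ^ k ×
           (∀ s → Unique s → All (λ n → v n < k) s → sum (map x s) ∈ₗ 0 ∷ L)
  subset-sums x v v-inj zero = [] , ≤-refl , λ where
    []      _ _        → here refl
    (_ ∷ _) _ (() ∷ _)
  subset-sums x v v-inj (suc k) with subset-sums x v v-inj k | em {P = ∃[ n ] v n ≡ k}
  ... | L , len , cover | no ∄n =
    L , ≤-trans len (m≤m+n (2 ^ k) _) , λ s s! s<1+k →
      cover s s! (tabulate λ {i} i∈s → ≤∧≢⇒< (s≤s⁻¹ (lookup s<1+k i∈s)) (λ vi≡k → ∄n (i , vi≡k)))
  ... | L , len , cover | yes (n , vn≡k) = L′ , len′ , cover′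
    where
    L′ : List ℕ
    -- By injectivity `n` is the only index at level `k`: the sums that avoid it come first, then
    -- those that use it. The `0` in the second part accounts for `x n` alone.
    L′ = L ++ map (x n +_) (0 ∷ L)

    len′ : length (0 ∷ L′) ≤ 2 ^ suc k
    len′ = begin
      suc (length L′)                                 ≡⟨ cong suc (length-++ L) ⟩
      length (0 ∷ L) + length (map (x n +_) (0 ∷ L))  ≡⟨ cong (length (0 ∷ L) +_) (length-map (x n +_) (0 ∷ L)) ⟩
      length (0 ∷ L) + length (0 ∷ L)                 ≤⟨ +-mono-≤ len len ⟩
      2 ^ k + 2 ^ k                                   ≡⟨ cong (2 ^ k +_) (sym (+-identityʳ _)) ⟩
      2 ^ suc k                                       ∎
      where open ≤-Reasoning

    cover-without : ∀ s → Unique s → All (λ i → v i < suc k) s → n ∉ₗ s → sum (map x s) ∈ₗ 0 ∷ L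
    cover-without s s! s<1+k n∉s = cover s s! (tabulate λ {i} i∈s →
      ≤∧≢⇒< (s≤s⁻¹ (lookup s<1+k i∈s))
        (λ vi≡k → n∉s (subst (_∈ₗ s) (v-inj i n (trans vi≡k (sym vn≡k))) i∈s)))

    cover′ : ∀ s → Unique s → All (λ i → v i < suc k) s → sum (map x s) ∈ₗ 0 ∷ L′
    cover′ s s! s<1+k with em {P = n ∈ₗ s}
    ... | no n∉s  = ∈-++⁺ˡ (cover-without s s! s<1+k n∉s)
    ... | yes n∈s with ∈-∃++ n∈s
    ...   | ys , zs , refl =
      subst (_∈ₗ 0 ∷ L′) (sym (sum-↭ (↭-map⁺ x s↭n∷t)))
        (∈-++⁺ʳ (0 ∷ L) (∈-map⁺ (x n +_) (case n∷t! of λ where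
          (n∉t ∷ t!) → case All-resp-↭ s↭n∷t s<1+k of λ where
            (_ ∷ t<1+k) → cover-without (ys ++ zs) t! t<1+k (Unique[x∷xs]⇒x∉xs n∷t!))))
      where
      s↭n∷t : s ↭ n ∷ ys ++ zs
      s↭n∷t = shift n ys zs
      n∷t! : Unique (n ∷ ys ++ zs)
      n∷t! = Unique-resp-↭ (setoid ℕ) (↭⇒↭ₛ s↭n∷t) s!

  finite-cardinality : DecidableEquality X → ∀ (P : Pred X 0ℓ) L → P ⊆ (_∈ₗ L) →
    ∃[ k ] HasCardinality P k × k ≤ length L
  finite-cardinality _≈?_ P L P⊆L =
    length xs , (xs , Unique-filter⁺ P? (deduplicate-! _≈?_ L) , xs≈P , refl) ,
    ≤-trans (length-filter P? (deduplicate _≈?_ L)) (length-deduplicate _≈?_ L)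
    where
    P? : ∀ b → _
    P? b = em {P = P b}
    xs = filter P? (deduplicate _≈?_ L)
    xs≈P : ∀ b → _
    xs≈P b = mk⇔ (proj₂ ∘ ∈-filter⁻ P? {xs = deduplicate _≈?_ L})
                 (λ b∈P → ∈-filter⁺ P? (∈-deduplicate⁺ _≈?_ (P⊆L b∈P)) b∈P)

-- Strongly summable ultrafilters

HasLastDigit : ℕ → Pred ℕ⁺ 0ℓ
HasLastDigit d b = ∃[ a ] EndsIn d a (value b)

-- For `d` prime to 3, `a` is the 3-adic valuation of `b`.
LargeWithLastDigit : ℕ → (ℕ → ℕ) → Pred ℕ⁺ 0ℓ
LargeWithLastDigit d h b = ∃[ a ] EndsIn d a (value b) × h a ≤ value b

levels-injective : ∀ {d} x (level : ℕ → ℕ) → 3 ∤ d → (∀ b → b ∈ FS x → b ∈ HasLastDigit d) →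
  (∀ n → EndsIn d (level n) (value (x n))) → ∀ m n → level m ≡ level n → m ≡ n
levels-injective {d} x level 3∤d FS⊆ ends m n eq with m ≟ n
... | yes m≡n = m≡n
... | no  m≢n = contradiction (proj₂ (FS⊆ (x m +⁺ x n) (pair∈FS x m≢n)))
  (EndsIn-double 3∤d (subst (λ a → EndsIn d a (value (x m))) eq (ends m)) (ends n))

module _ (p : Ultrafilter ℕ⁺ ℓ) (ss : StronglySummable p) where
  open Ultrafilter p hiding (sets)

  excluded-middle : ExcludedMiddle 0ℓ
  excluded-middle {Q} with ultra (λ _ → Q)
  ... | inj₂ ¬Q∈ = no λ q → ∅∉ (upward (λ ¬q → ¬q q) ¬Q∈)
  ... | inj₁ Q∈ with ss (λ _ → Q) Q∈
  -- Membership of `x 0` in the constant predicate is itself a proof of `Q`.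
  ...   | x , FS⊆Q , _ = yes (FS⊆Q {x 0} (term∈FS x 0))

  last-digit∈ : ∃[ d ] 3 ∤ d × HasLastDigit d ∈ sets p
  last-digit∈ with ultra (HasLastDigit 1)
  ... | inj₁ one∈  = 1 , >⇒∤ (s≤s (s≤s z≤n)) , one∈
  ... | inj₂ ¬one∈ = 2 , >⇒∤ (s≤s (s≤s (s≤s z≤n))) , upward (λ {b} → ¬one⇒two {b}) ¬one∈
    where
    ¬one⇒two : ∁ (HasLastDigit 1) ⊆ HasLastDigit 2
    ¬one⇒two {b} ¬one = case EndsIn-exists (value b) (value>0 b) of λ where
      (a , inj₁ one) → contradiction (a , one) ¬one
      (a , inj₂ two) → a , two

  large∈ : ∀ {d} h → 3 ∤ d → HasLastDigit d ∈ sets p → LargeWithLastDigit d h ∈ sets p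
  large∈ {d} h 3∤d d∈ with ultra (LargeWithLastDigit d h)
  ... | inj₁ large = large
  ... | inj₂ ¬large with ss _ (∩-closed d∈ ¬large)
  ...   | x , FS⊆ , _ = ⊥-elim (bounded-not-injective level _ level< level-inj)
    where
    level : ℕ → ℕ
    level n = proj₁ (proj₁ (FS⊆ {x n} (term∈FS x n)))
    ends : ∀ n → EndsIn d (level n) (value (x n))
    ends n = proj₂ (proj₁ (FS⊆ {x n} (term∈FS x n)))
    level-inj : ∀ m n → level m ≡ level n → m ≡ n
    level-inj = levels-injective x level 3∤d (λ b b∈ → proj₁ (FS⊆ {b} b∈)) ends
    -- The first summand serves the terms of level at most `level 0`, the second all others.
    level< : ∀ n → level n < suc (level 0) + h (level 0)
    level< n with level n ≤? level 0
    ... | yes ≤l₀ = ≤-trans (s≤s ≤l₀) (m≤m+n (suc (level 0)) _)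
    ... | no  ≰l₀ = begin-strict
      level n                      <⟨ EndsIn⇒< 3∤d (ends n) ⟩
      value (x n)                  ≤⟨ m≤n+m (value (x n)) (value (x 0)) ⟩
      value (x 0) + value (x n)    ≤⟨ ≰⇒≥ h≰sum ⟩
      h (level 0)                  ≤⟨ m≤n+m _ (suc (level 0)) ⟩
      suc (level 0) + h (level 0)  ∎
      where
      open ≤-Reasoning
      0≢n : 0 ≢ n
      0≢n refl = ≰l₀ ≤-refl
      -- The sum has level `level 0`, so reaching `h (level 0)` would make it large, while `FS x`
      -- lies in the complement.
      h≰sum : h (level 0) ≰ value (x 0) + value (x n)
      h≰sum h≤ = proj₂ (FS⊆ {x 0 +⁺ x n} (pair∈FS x 0≢n))
        (level 0 , EndsIn-absorbs (≰⇒> ≰l₀) (ends 0) (ends n) , h≤)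

theorem3 : ∀ {ℓ} (p : Ultrafilter ℕ⁺ ℓ) → StronglySummable p → Rapid p
theorem3 p ss f with last-digit∈ p ss
... | d , 3∤d , d∈ with ss _ (large∈ p ss h 3∤d d∈)
  where
  h : ℕ → ℕ
  -- The index 0 contributes `f` at 1, which is harmless in an upper bound.
  h a = proj₁ (upper-bound (λ i → value (f (i ⁺))) (2 ^ suc a))
... | x , FS⊆ , FS∈ = FS x , FS∈ , few
  where
  level : ℕ → ℕ
  level n = proj₁ (FS⊆ {x n} (term∈FS x n))

  ends : ∀ n → EndsIn d (level n) (value (x n))
  ends n = proj₁ (proj₂ (FS⊆ {x n} (term∈FS x n)))

  level-inj : ∀ m n → level m ≡ level n → m ≡ n
  level-inj = levels-injective x level 3∤d (λ b b∈ → map₂ proj₁ (FS⊆ {b} b∈)) ends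

  -- Otherwise `f i` is among the values bounded by `h (level n)`, which is at most `x n`.
  level-bound : ∀ i n → value (x n) < value (f i) → 2 ^ suc (level n) ≤ value i
  level-bound i n xn<fi = ≮⇒≥ λ i<2^ → <⇒≱ xn<fi (begin
    value (f i)            ≡⟨ cong (value ∘ f) (value⁺ i) ⟨
    value (f (value i ⁺))  ≤⟨ proj₂ (upper-bound (λ i → value (f (i ⁺))) _) i<2^ ⟩
    _                      ≤⟨ proj₂ (proj₂ (FS⊆ {x n} (term∈FS x n))) ⟩
    value (x n)            ∎)
    where open ≤-Reasoning

  few : ∀ i → ∃[ k ] HasCardinality (FS x ∩ Below (f i)) k × k < value i
  few i with binary-log (value i) {{>-nonZero (value>0 i)}}
  ... | k , 2^k≤i , i<2^1+k
    with subset-sums (excluded-middle p ss) (value ∘ x) level level-inj k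
  ...   | L , len , cover
    with finite-cardinality (excluded-middle p ss) (≟-refinement _≟_) (FS x ∩ Below (f i))
      (map _⁺ L) (λ {b} → listed {b})
    where
    listed : (FS x ∩ Below (f i)) ⊆ (_∈ₗ map _⁺ L)
    listed {b} ((s , s! , _ , b≡) , b<fi)
      -- Each term is at most the sum `b`, hence below `f i`. A level `k` or more would then force
      -- `2 ^ suc k ≤ i`, against the choice of `k`.
      with subst (_∈ₗ 0 ∷ L) (sym b≡) (cover s s! (tabulate λ {n} n∈s →
        ≰⇒> λ k≤v → <⇒≱ i<2^1+k (≤-trans (^-monoʳ-≤ 2 (s≤s k≤v))
          (level-bound i n (≤-<-trans (≤-trans (∈⇒≤sum (value ∘ x) n∈s) (≤-reflexive (sym b≡))) b<fi)))))
    -- Discarding the empty sum is what makes the final count strictly less than `2 ^ k`.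
    ... | here b≡0  = contradiction b≡0 (m<n⇒n≢0 (value>0 b))
    ... | there b∈L = subst (_∈ₗ map _⁺ L) (value⁺ b) (∈-map⁺ _⁺ b∈L)
  ...     | c , card , c≤ = c , card , (begin-strict
    c                  ≤⟨ c≤ ⟩
    length (map _⁺ L)  ≡⟨ length-map _⁺ L ⟩
    length L           <⟨ len ⟩
    2 ^ k              ≤⟨ 2^k≤i ⟩
    value i            ∎)
    where open ≤-Reasoning
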